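{- The following statements are equivalent: (1) For all $k>1$, every infinite word on the alphabet $\{1,2,\dots,k\}$ has two adjacent factors with equal length and equal sum. (1a) For all $k>1$, there exists $R=R(k)$ such that every word on $\{1,2,\dots,k\}$ of length $R$ has two adjacent factors with equal length and equal sum. (2) For all $n>1$, if $x_1<x_2<x_3<\cdots$ is an infinite sequence of positive integers with $x_{i+1}-x_i\le n$ for all $i\ge1$, then there exist $1\le i<j<k$ with $x_i+x_k=2x_j$ and $i+k=2j$. (2a) For all $n>1$, there exists $S=S(n)$ such that if $x_1<x_2<\cdots<x_S$ are positive integers with $x_{i+1}-x_i\le n$ for $1\le i\le S-1$, then there exist $1\le i<j<k\le S$ with $x_i+x_k=2x_j$ and $i+k=2j$. (3) For all $t>1$, if $\mathbb{N}=A_1\cup A_2\cup\cdots\cup A_t$ (the sets $A_q$ not necessarily disjoint), then there exists $q$, $1\le q\le t$, such that, writing $A_q=\{x_1<x_2<\cdots\}$, there are $1\le i<j<k$ with $x_i+x_k=2x_j$ and $i+k=2j$. (3a) For all $t>1$, there exists $T=T(t)$ such that for all $a\ge1$, if $\{a,a+1,\dots,a+T-1\}=A_1\cup\cdots\cup A_t$ (the sets not necessarily disjoint), then there exists $q$, $1\le q\le t$, such that, writing $A_q=\{x_1<x_2<\cdots<x_p\}$, there are $1\le i<j<k\le p$ with $x_i+x_k=2x_j$ and $i+k=2j$.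
   Context: A word on a finite alphabet $S\subset\mathbb{Z}$ is a (finite or infinite) sequence $x_1x_2\cdots$ of elements of $S$. A factor of length $\ell$ is a block $x_mx_{m+1}\cdots x_{m+\ell-1}$ of consecutive letters, and its sum is $x_m+\cdots+x_{m+\ell-1}$. Two factors are adjacent if the second begins immediately after the first ends. -}

module Defs where

open import Data.Fin.Base using (Fin; toℕ)
open import Data.List.Base using (List; applyUpTo; drop; length; sum; take)
open import Data.List.Relation.Unary.All using (All)
open import Data.Nat.Base using (ℕ; suc; _+_; _*_; _∸_; _≤_; _<_)
open import Data.Product.Base using (∃-syntax; _×_)
open import Data.Sum.Base using (_⊎_)
open import Function.Base using (id)
open import Level using (0ℓ)
open import Relation.Binary.PropositionalEquality.Core using (_≡_)
open import Relation.Unary using (Pred; _∈_; _≐_; ⋃)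

-- Positions in words and sequences are counted from 0.  Every condition on
-- positions used below is invariant under a common shift, in particular
-- i + k = 2j, so this agrees with counting from 1.

Alphabet : ℕ → Pred ℕ 0ℓ
Alphabet k c = 1 ≤ c × c ≤ k

factor : List ℕ → ℕ → ℕ → List ℕ
factor w m ℓ = take ℓ (drop m w)

factor∞ : (ℕ → ℕ) → ℕ → ℕ → List ℕ
factor∞ w m ℓ = applyUpTo (λ r → w (m + r)) ℓ

-- Factors are nonempty: with ℓ = 0 every word would qualify.

HasAdditiveSquare : List ℕ → Set
HasAdditiveSquare w = ∃[ m ] ∃[ ℓ ]
  1 ≤ ℓ × m + ℓ + ℓ ≤ length w × sum (factor w m ℓ) ≡ sum (factor w (m + ℓ) ℓ)

HasAdditiveSquare∞ : (ℕ → ℕ) → Set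
HasAdditiveSquare∞ w = ∃[ m ] ∃[ ℓ ]
  1 ≤ ℓ × sum (factor∞ w m ℓ) ≡ sum (factor∞ w (m + ℓ) ℓ)

-- A sequence is a function x on an index type I whose elements have positions
-- given by pos: I = Fin p with pos = toℕ for sequences of length p, and I = ℕ
-- with pos = id for infinite sequences.

module _ {I : Set} (pos : I → ℕ) (x : I → ℕ) where

  StrictlyIncreasing : Set
  StrictlyIncreasing = ∀ i j → pos i < pos j → x i < x j

  GapsAtMost : ℕ → Set
  GapsAtMost n = ∀ i j → pos j ≡ suc (pos i) → x j ∸ x i ≤ n

  HasDoubleAP : Set
  HasDoubleAP = ∃[ i ] ∃[ j ] ∃[ k ]
    pos i < pos j × pos j < pos k × x i + x k ≡ 2 * x j × pos i + pos k ≡ 2 * pos j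

  Enumerates : Pred ℕ 0ℓ → Set
  Enumerates A = StrictlyIncreasing × A ≐ (λ n → ∃[ i ] x i ≡ n)

FiniteSetHasDoubleAP : Pred ℕ 0ℓ → Set
FiniteSetHasDoubleAP A = ∃[ p ] ∃[ x ] Enumerates (toℕ {p}) x A × HasDoubleAP (toℕ {p}) x

InfiniteSetHasDoubleAP : Pred ℕ 0ℓ → Set
InfiniteSetHasDoubleAP A = ∃[ x ] Enumerates id x A × HasDoubleAP id x

-- A member of a finite cover of the positive integers may be finite or infinite.

SetHasDoubleAP : Pred ℕ 0ℓ → Set
SetHasDoubleAP A = FiniteSetHasDoubleAP A ⊎ InfiniteSetHasDoubleAP A

Positive : Pred ℕ 0ℓ
Positive n = 1 ≤ n

Interval : ℕ → ℕ → Pred ℕ 0ℓ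
Interval a T n = a ≤ n × n < a + T

InfiniteWordsHaveAdditiveSquares : Set
InfiniteWordsHaveAdditiveSquares =
  ∀ k → 1 < k → (w : ℕ → ℕ) → (∀ i → w i ∈ Alphabet k) → HasAdditiveSquare∞ w

LongWordsHaveAdditiveSquares : Set
LongWordsHaveAdditiveSquares =
  ∀ k → 1 < k → ∃[ R ] ∀ (w : List ℕ) → length w ≡ R → All (Alphabet k) w →
  HasAdditiveSquare w

InfiniteSequencesHaveDoubleAPs : Set
InfiniteSequencesHaveDoubleAPs =
  ∀ n → 1 < n → (x : ℕ → ℕ) → (∀ i → x i ∈ Positive) →
  StrictlyIncreasing id x → GapsAtMost id x n → HasDoubleAP id x

LongSequencesHaveDoubleAPs : Set
LongSequencesHaveDoubleAPs =
  ∀ n → 1 < n → ∃[ S ] ∀ (x : Fin S → ℕ) → (∀ i → x i ∈ Positive) →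
  StrictlyIncreasing toℕ x → GapsAtMost toℕ x n → HasDoubleAP toℕ x

CoversOfPositivesHaveDoubleAPs : Set₁
CoversOfPositivesHaveDoubleAPs =
  ∀ t → 1 < t → (A : Fin t → Pred ℕ 0ℓ) → Positive ≐ ⋃ (Fin t) A →
  ∃[ q ] SetHasDoubleAP (A q)

CoversOfLongIntervalsHaveDoubleAPs : Set₁
CoversOfLongIntervalsHaveDoubleAPs =
  ∀ t → 1 < t → ∃[ T ] ∀ a → 1 ≤ a → (A : Fin t → Pred ℕ 0ℓ) →
  Interval a T ≐ ⋃ (Fin t) A → ∃[ q ] FiniteSetHasDoubleAP (A q)

{-# OPTIONS --safe #-}
module Submission where

-- A word is the difference sequence of an increasing sequence, and an additive
-- square of factors of length ℓ starting at m is a double progression at the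
-- indices m, m + ℓ, m + 2ℓ; König's lemma passes from infinite words to long
-- finite ones.  For covers, induct on the number of sets: a set with bounded
-- gaps contains a long sequence with bounded gaps, and a long gap in one set is
-- an interval covered by the others.  Conversely, finitely many translates of a
-- sequence with bounded gaps cover the positive integers.

open import Axiom.ExcludedMiddle using (ExcludedMiddle)
open import Data.Fin.Base using (Fin; zero; suc; toℕ; fromℕ<; inject₁)
open import Data.Fin.Properties using (toℕ-fromℕ<; toℕ-inject₁; toℕ-injective; toℕ<n)
open import Data.List.Base using ([]; _∷_; _∷ʳ_; applyUpTo; length; take; [_])
open import Data.List.Properties using (applyUpTo-∷ʳ; length-applyUpTo)
open import Data.List.Relation.Unary.All using (All; []; _∷_)
open import Data.List.Relation.Unary.All.Properties using (applyUpTo⁺₂)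
open import Data.Nat.Base
open import Data.Nat.Induction using (<-rec)
open import Data.Nat.ListAction using (sum)
open import Data.Nat.ListAction.Properties using (sum-++)
open import Data.Nat.Properties
open import Data.Nat.Tactic.RingSolver using (solve-∀)
open import Data.Product.Base using (∃-syntax; Σ-syntax; _×_; _,_; proj₁; proj₂; map₂)
open import Data.Sum.Base using (_⊎_; inj₁; inj₂)
open import Function.Base using (id; _∘_)
open import Function.Bundles using (_⇔_; mk⇔)
open import Level using (0ℓ)
open import Relation.Binary.PropositionalEquality
  using (_≡_; refl; sym; trans; cong; cong₂; subst; subst₂; module ≡-Reasoning)
open import Relation.Nullary using (¬_; yes; no; contradiction)
open import Relation.Nullary.Decidable using (decidable-stable)
open import Relation.Nullary.Negation using (¬∃⟶∀¬)
open import Relation.Unary using (Pred; Decidable; _∈_)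
open import Defs

-- Finite words as prefixes of functions on the natural numbers

+-swapʳ : ∀ a b c → a + b + c ≡ a + c + b
+-swapʳ = solve-∀

AgreeBelow : ℕ → (ℕ → ℕ) → (ℕ → ℕ) → Set
AgreeBelow n f g = ∀ i → i < n → f i ≡ g i

applyUpTo-cong : ∀ {n f g} → AgreeBelow n f g → applyUpTo f n ≡ applyUpTo g n
applyUpTo-cong {zero}  f≡g = refl
applyUpTo-cong {suc n} f≡g =
  cong₂ _∷_ (f≡g 0 z<s) (applyUpTo-cong λ i i<n → f≡g (suc i) (s<s i<n))

take-applyUpTo : ∀ (f : ℕ → ℕ) {ℓ n} → ℓ ≤ n → take ℓ (applyUpTo f n) ≡ applyUpTo f ℓ
take-applyUpTo f z≤n       = refl
take-applyUpTo f (s≤s ℓ≤n) = cong (f 0 ∷_) (take-applyUpTo (f ∘ suc) ℓ≤n)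

factor-applyUpTo : ∀ f m ℓ {n} → m + ℓ ≤ n → factor (applyUpTo f n) m ℓ ≡ factor∞ f m ℓ
factor-applyUpTo f zero    ℓ ℓ≤n         = take-applyUpTo f ℓ≤n
factor-applyUpTo f (suc m) ℓ (s≤s m+ℓ≤n) = factor-applyUpTo (f ∘ suc) m ℓ m+ℓ≤n

factor∞-cong : ∀ {n f g} → AgreeBelow n f g →
  ∀ m ℓ → m + ℓ ≤ n → factor∞ f m ℓ ≡ factor∞ g m ℓ
factor∞-cong f≡g m ℓ m+ℓ≤n =
  applyUpTo-cong λ r r<ℓ → f≡g (m + r) (<-≤-trans (+-monoʳ-< m r<ℓ) m+ℓ≤n)

sum-applyUpTo-suc : ∀ f n → sum (applyUpTo f (suc n)) ≡ sum (applyUpTo f n) + f n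
sum-applyUpTo-suc f n = begin
  sum (applyUpTo f (suc n))         ≡⟨ cong sum (applyUpTo-∷ʳ f n) ⟨
  sum (applyUpTo f n ∷ʳ f n)        ≡⟨ sum-++ (applyUpTo f n) [ f n ] ⟩
  sum (applyUpTo f n) + (f n + 0)   ≡⟨ cong (sum (applyUpTo f n) +_) (+-identityʳ (f n)) ⟩
  sum (applyUpTo f n) + f n         ∎
  where open ≡-Reasoning

-- Finite words are handled as prefixes of total functions: limits and telescoping sums then involve
-- no list bookkeeping, only the bound `n`.
HasAdditiveSquareBelow : ℕ → (ℕ → ℕ) → Set
HasAdditiveSquareBelow n f = ∃[ m ] ∃[ ℓ ]
  1 ≤ ℓ × m + ℓ + ℓ ≤ n × sum (factor∞ f m ℓ) ≡ sum (factor∞ f (m + ℓ) ℓ)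

square-mono : ∀ {m n f} → m ≤ n → HasAdditiveSquareBelow m f → HasAdditiveSquareBelow n f
square-mono m≤n (i , ℓ , 1≤ℓ , end , eq) = i , ℓ , 1≤ℓ , ≤-trans end m≤n , eq

square-cong : ∀ {n f g} → AgreeBelow n f g →
  HasAdditiveSquareBelow n f → HasAdditiveSquareBelow n g
square-cong f≡g (m , ℓ , 1≤ℓ , end , eq) = m , ℓ , 1≤ℓ , end ,
  trans (cong sum (sym (factor∞-cong f≡g m ℓ (m+n≤o⇒m≤o (m + ℓ) end))))
        (trans eq (cong sum (factor∞-cong f≡g (m + ℓ) ℓ end)))

square-toList : ∀ {n f} → HasAdditiveSquareBelow n f → HasAdditiveSquare (applyUpTo f n)
square-toList {n} {f} (m , ℓ , 1≤ℓ , end , eq) =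
  m , ℓ , 1≤ℓ , subst (m + ℓ + ℓ ≤_) (sym (length-applyUpTo f n)) end ,
  trans (cong sum (factor-applyUpTo f m ℓ (m+n≤o⇒m≤o (m + ℓ) end)))
        (trans eq (cong sum (sym (factor-applyUpTo f (m + ℓ) ℓ end))))

square-fromList : ∀ {n f} → HasAdditiveSquare (applyUpTo f n) → HasAdditiveSquareBelow n f
square-fromList {n} {f} (m , ℓ , 1≤ℓ , end′ , eq) =
  m , ℓ , 1≤ℓ , end ,
  trans (cong sum (sym (factor-applyUpTo f m ℓ (m+n≤o⇒m≤o (m + ℓ) end))))
        (trans eq (cong sum (factor-applyUpTo f (m + ℓ) ℓ end)))
  where
  end : m + ℓ + ℓ ≤ n
  end = subst (m + ℓ + ℓ ≤_) (length-applyUpTo f n) end′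

-- The element `c` fills the positions past the end of the list, so that `P` holds everywhere.
list-asFunction : ∀ {P : Pred ℕ 0ℓ} {c} → P c → ∀ {w} → All P w →
  ∃[ f ] (∀ i → P (f i)) × w ≡ applyUpTo f (length w)
list-asFunction {c = c} Pc []                  = (λ _ → c) , (λ _ → Pc) , refl
list-asFunction {P} Pc (_∷_ {x = a} Pa Pw) with list-asFunction Pc Pw
... | f , Pf , w≡ = g , Pg , cong (a ∷_) w≡
  where
  g : ℕ → ℕ
  g zero    = a
  g (suc i) = f i
  Pg : ∀ i → P (g i)
  Pg zero    = Pa
  Pg (suc i) = Pf i

-- The form in which compactness delivers its conclusion; the statements on long words and on long
-- sequences are both derived from it.
LongPrefixesHaveAdditiveSquares : Set
LongPrefixesHaveAdditiveSquares =
  ∀ k → 1 < k → ∃[ R ] ∀ f → (∀ i → f i ∈ Alphabet k) → HasAdditiveSquareBelow R f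

longPrefixes⇒longWords : LongPrefixesHaveAdditiveSquares → LongWordsHaveAdditiveSquares
longPrefixes⇒longWords squares k 1<k with squares k 1<k
... | R , square = R , λ w |w|≡R w∈k →
  -- The filler letter is 1.
  let f , f∈k , w≡ = list-asFunction (s≤s z≤n , <⇒≤ 1<k) w∈k
  in subst HasAdditiveSquare (sym w≡)
       (square-toList (subst (λ n → HasAdditiveSquareBelow n f) (sym |w|≡R) (square f f∈k)))

longWords⇒infiniteWords : LongWordsHaveAdditiveSquares → InfiniteWordsHaveAdditiveSquares
longWords⇒infiniteWords squares k 1<k w w∈k with squares k 1<k
... | R , square
  with square-fromList {R} {w}
         (square (applyUpTo w R) (length-applyUpTo w R) (applyUpTo⁺₂ w R w∈k))
... | m , ℓ , 1≤ℓ , _ , eq = m , ℓ , 1≤ℓ , eq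

-- Double progressions and additive squares

module _ (x f : ℕ → ℕ) (step : ∀ i → x (suc i) ≡ x i + f i) where

  telescope : ∀ m ℓ → x (m + ℓ) ≡ x m + sum (factor∞ f m ℓ)
  telescope m zero    = trans (cong x (+-identityʳ m)) (sym (+-identityʳ (x m)))
  telescope m (suc ℓ) = begin
    x (m + suc ℓ)                              ≡⟨ cong x (+-suc m ℓ) ⟩
    x (suc (m + ℓ))                            ≡⟨ step (m + ℓ) ⟩
    x (m + ℓ) + f (m + ℓ)                      ≡⟨ cong (_+ f (m + ℓ)) (telescope m ℓ) ⟩
    x m + sum (factor∞ f m ℓ) + f (m + ℓ)      ≡⟨ +-assoc (x m) _ _ ⟩
    x m + (sum (factor∞ f m ℓ) + f (m + ℓ))    ≡⟨ cong (x m +_) (sum-applyUpTo-suc _ ℓ) ⟨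
    x m + sum (factor∞ f m (suc ℓ))            ∎
    where open ≡-Reasoning

  -- By telescoping, the two factor sums are the differences of `x` from `m` to `m + ℓ` and from
  -- `m + ℓ` to `m + ℓ + ℓ`; the sums are rearranged to avoid subtraction.
  square⇒AP : ∀ m ℓ →
    sum (factor∞ f m ℓ) ≡ sum (factor∞ f (m + ℓ) ℓ) →
    x m + x (m + ℓ + ℓ) ≡ 2 * x (m + ℓ)
  square⇒AP m ℓ eq = begin
    x m + x (m + ℓ + ℓ)   ≡⟨ cong (x m +_) (telescope (m + ℓ) ℓ) ⟩
    x m + (x (m + ℓ) + s) ≡⟨ swap (x m) (x (m + ℓ)) s ⟩
    x m + s + x (m + ℓ)   ≡⟨ cong (λ s′ → x m + s′ + x (m + ℓ)) eq ⟨
    x m + sum (factor∞ f m ℓ) + x (m + ℓ) ≡⟨ cong (_+ x (m + ℓ)) (telescope m ℓ) ⟨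
    x (m + ℓ) + x (m + ℓ) ≡⟨ cong (x (m + ℓ) +_) (+-identityʳ _) ⟨
    2 * x (m + ℓ)         ∎
    where
    open ≡-Reasoning
    s : ℕ
    s = sum (factor∞ f (m + ℓ) ℓ)
    swap : ∀ a b c → a + (b + c) ≡ a + c + b
    swap = solve-∀

  AP⇒square : ∀ m ℓ →
    x m + x (m + ℓ + ℓ) ≡ 2 * x (m + ℓ) →
    sum (factor∞ f m ℓ) ≡ sum (factor∞ f (m + ℓ) ℓ)
  AP⇒square m ℓ eq = sym (+-cancelˡ-≡ (x m + x (m + ℓ)) _ _ (begin
    x m + x (m + ℓ) + sum (factor∞ f (m + ℓ) ℓ)   ≡⟨ +-assoc (x m) _ _ ⟩
    x m + (x (m + ℓ) + sum (factor∞ f (m + ℓ) ℓ)) ≡⟨ cong (x m +_) (telescope (m + ℓ) ℓ) ⟨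
    x m + x (m + ℓ + ℓ)                           ≡⟨ eq ⟩
    2 * x (m + ℓ)                                 ≡⟨ cong (x (m + ℓ) +_) (+-identityʳ _) ⟩
    x (m + ℓ) + x (m + ℓ)                         ≡⟨ cong (_+ x (m + ℓ)) (telescope m ℓ) ⟩
    x m + sum (factor∞ f m ℓ) + x (m + ℓ)         ≡⟨ +-swapʳ (x m) _ (x (m + ℓ)) ⟩
    x m + x (m + ℓ) + sum (factor∞ f m ℓ)         ∎))
    where
    open ≡-Reasoning

stepwise⇒increasing : ∀ {x} → (∀ i → x i < x (suc i)) → StrictlyIncreasing id x
stepwise⇒increasing step i (suc j) i<1+j with m<1+n⇒m<n∨m≡n i<1+j
... | inj₁ i<j  = <-trans (stepwise⇒increasing step i j i<j) (step j)
... | inj₂ refl = step j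

infiniteSequences⇒infiniteWords :
  InfiniteSequencesHaveDoubleAPs → InfiniteWordsHaveAdditiveSquares
infiniteSequences⇒infiniteWords doubleAPs k 1<k w w∈k
  with doubleAPs k 1<k x (λ _ → s≤s z≤n) (stepwise⇒increasing increasing) gaps
  where
  x : ℕ → ℕ
  -- Partial sums start from 1 to keep every term positive.
  x i = suc (sum (applyUpTo w i))
  step : ∀ i → x (suc i) ≡ x i + w i
  step i = cong suc (sum-applyUpTo-suc w i)
  increasing : ∀ i → x i < x (suc i)
  increasing i = subst (x i <_) (sym (step i)) (m<m+n (x i) (proj₁ (w∈k i)))
  gaps : GapsAtMost id x k
  gaps i _ refl = m≤n+o⇒m∸n≤o (x (suc i)) (x i)
    (subst (_≤ x i + k) (sym (step i)) (+-monoʳ-≤ (x i) (proj₂ (w∈k i))))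
-- The factor length is `ℓ = j ∸ i`: then `j = i + ℓ`, and `i + l = 2j` forces `l = i + ℓ + ℓ`.
... | i , j , l , i<j , j<l , AP , i+l≡2j = i , j ∸ i , m<n⇒0<n∸m i<j ,
  AP⇒square (λ i → suc (sum (applyUpTo w i))) w (λ i → cong suc (sum-applyUpTo-suc w i)) i (j ∸ i)
    (subst₂ (λ j l → suc (sum (applyUpTo w i)) + suc (sum (applyUpTo w l))
                     ≡ 2 * suc (sum (applyUpTo w j)))
       (sym i+d≡j)
       (+-cancelˡ-≡ i _ _ (begin
          i + l                           ≡⟨ i+l≡2j ⟩
          2 * j                           ≡⟨ cong (2 *_) i+d≡j ⟨
          2 * (i + (j ∸ i))               ≡⟨ double i (j ∸ i) ⟩
          i + (i + (j ∸ i) + (j ∸ i))     ∎))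
       AP)
  where
  open ≡-Reasoning
  i+d≡j : i + (j ∸ i) ≡ j
  i+d≡j = m+[n∸m]≡n (<⇒≤ i<j)
  double : ∀ i d → 2 * (i + d) ≡ i + (i + d + d)
  double = solve-∀

Step : ℕ → ℕ → ℕ → Set
Step n a b = a < b × b ∸ a ≤ n

-- Past its last term the sequence continues by steps of 1, which `1 ≤ n` allows; its differences
-- then form an infinite word.
extend : ∀ {n} → 1 ≤ n → ∀ {r} (x : Fin (suc r) → ℕ) →
  (∀ i → Step n (x (inject₁ i)) (x (suc i))) →
  Σ[ y ∈ (ℕ → ℕ) ] (∀ i → y (toℕ i) ≡ x i) × (∀ i → Step n (y i) (y (suc i)))
extend {n} 1≤n {zero} x _ = (λ i → i + x zero) , (λ where zero → refl) ,
  λ i → n<1+n _ , subst (_≤ n) (sym (m+n∸n≡m 1 (i + x zero))) 1≤n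
extend {n} 1≤n {suc r} x steps with extend 1≤n {r} (x ∘ suc) (steps ∘ suc)
... | y , y≡x , y-steps = z , z≡x , z-steps
  where
  z : ℕ → ℕ
  z zero    = x zero
  z (suc i) = y i
  z≡x : ∀ i → z (toℕ i) ≡ x i
  z≡x zero    = refl
  z≡x (suc i) = y≡x i
  z-steps : ∀ i → Step n (z i) (z (suc i))
  z-steps zero    = subst (Step n (x zero)) (sym (y≡x zero)) (steps zero)
  z-steps (suc i) = y-steps i

longPrefixes⇒longSequences : LongPrefixesHaveAdditiveSquares → LongSequencesHaveDoubleAPs
longPrefixes⇒longSequences squares n 1<n with squares n 1<n
-- The `R` letters are the differences of `R + 1` terms, and a square ending by `R` gives indices at
-- most `R`.
... | R , square = suc R , λ x _ increasing gaps → doubleAP x λ i →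
  increasing (inject₁ i) (suc i) (≤-reflexive (sym (toℕ-suc i))) ,
  gaps (inject₁ i) (suc i) (toℕ-suc i)
  where
  toℕ-suc : ∀ {r} (i : Fin r) → toℕ (suc i) ≡ suc (toℕ (inject₁ i))
  toℕ-suc i = cong suc (sym (toℕ-inject₁ i))
  double : ∀ m ℓ → m + (m + ℓ + ℓ) ≡ 2 * (m + ℓ)
  double = solve-∀
  doubleAP : (x : Fin (suc R) → ℕ) → (∀ i → Step n (x (inject₁ i)) (x (suc i))) →
    HasDoubleAP toℕ x
  doubleAP x steps with extend (<⇒≤ 1<n) x steps
  ... | y , y≡x , y-steps
    with square (λ i → y (suc i) ∸ y i)
           (λ i → m<n⇒0<n∸m (proj₁ (y-steps i)) , proj₂ (y-steps i))
  ... | m , ℓ , 1≤ℓ , end , eq =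
    fromℕ< i<1+R , fromℕ< j<1+R , fromℕ< k<1+R ,
    subst₂ _<_ (sym (toℕ-fromℕ< i<1+R)) (sym (toℕ-fromℕ< j<1+R)) (m<m+n m 1≤ℓ) ,
    subst₂ _<_ (sym (toℕ-fromℕ< j<1+R)) (sym (toℕ-fromℕ< k<1+R)) (m<m+n (m + ℓ) 1≤ℓ) ,
    trans (sym (cong₂ _+_ (at i<1+R) (at k<1+R))) (trans AP (cong (2 *_) (at j<1+R))) ,
    trans (cong₂ _+_ (toℕ-fromℕ< i<1+R) (toℕ-fromℕ< k<1+R))
      (trans (double m ℓ) (cong (2 *_) (sym (toℕ-fromℕ< j<1+R))))
    where
    AP : y m + y (m + ℓ + ℓ) ≡ 2 * y (m + ℓ)
    AP = square⇒AP y _ (λ i → sym (m+[n∸m]≡n (<⇒≤ (proj₁ (y-steps i))))) m ℓ eq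
    k<1+R : m + ℓ + ℓ < suc R
    k<1+R = s≤s end
    j<1+R : m + ℓ < suc R
    j<1+R = ≤-<-trans (m≤m+n (m + ℓ) ℓ) k<1+R
    i<1+R : m < suc R
    i<1+R = ≤-<-trans (m≤m+n m ℓ) j<1+R
    at : ∀ {a} (a<1+R : a < suc R) → y a ≡ x (fromℕ< a<1+R)
    at a<1+R = trans (cong y (sym (toℕ-fromℕ< a<1+R))) (y≡x (fromℕ< a<1+R))

longSequences⇒infiniteSequences :
  LongSequencesHaveDoubleAPs → InfiniteSequencesHaveDoubleAPs
longSequences⇒infiniteSequences doubleAPs n 1<n x positive increasing gaps
  with doubleAPs n 1<n
... | S , doubleAP
  with doubleAP (x ∘ toℕ) (λ i → positive (toℕ i))
         (λ i j → increasing (toℕ i) (toℕ j)) (λ i j → gaps (toℕ i) (toℕ j))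
... | i , j , k , AP = toℕ i , toℕ j , toℕ k , AP

-- Ranks

-- The counting function of `A`, with the bound itself excluded, so that the least element has rank
-- 0.
rank : {A : Pred ℕ 0ℓ} → Decidable A → ℕ → ℕ
rank A? zero = 0
rank A? (suc n) with A? n
... | yes _ = suc (rank A? n)
... | no  _ = rank A? n

rank-cong : ∀ {A B : Pred ℕ 0ℓ} (A? : Decidable A) (B? : Decidable B) n →
  (∀ m → m < n → (A m → B m) × (B m → A m)) → rank A? n ≡ rank B? n
rank-cong A? B? zero    A⇔B = refl
rank-cong A? B? (suc n) A⇔B
  with A? n | B? n | rank-cong A? B? n (λ m m<n → A⇔B m (m<n⇒m<1+n m<n))
... | yes _  | yes _  | eq = cong suc eq
... | no _   | no _   | eq = eq
... | yes An | no ¬Bn | _  = contradiction (proj₁ (A⇔B n ≤-refl) An) ¬Bn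
... | no ¬An | yes Bn | _  = contradiction (proj₂ (A⇔B n ≤-refl) Bn) ¬An

-- A double progression of A expressed without reference to an enumeration of A:
-- the index of an element of A is its rank.

HasRankedAP : {A : Pred ℕ 0ℓ} → Decidable A → Set
HasRankedAP {A} A? = ∃[ a ] ∃[ b ] ∃[ c ]
  (A a × A b × A c) × a < b × b < c × a + c ≡ 2 * b ×
  rank A? a + rank A? c ≡ 2 * rank A? b

module _ {A : Pred ℕ 0ℓ} (A? : Decidable A) where

  rank-suc : ∀ {n} → A n → rank A? (suc n) ≡ suc (rank A? n)
  rank-suc {n} An with A? n
  ... | yes _  = refl
  ... | no ¬An = contradiction An ¬An

  rank-≤-suc : ∀ n → rank A? n ≤ rank A? (suc n)
  rank-≤-suc n with A? n
  ... | yes _ = n≤1+n _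
  ... | no  _ = ≤-refl

  rank-mono : ∀ {m n} → m ≤ n → rank A? m ≤ rank A? n
  rank-mono {m} {zero}  z≤n = z≤n
  rank-mono {m} {suc n} m≤1+n with m≤n⇒m<n∨m≡n m≤1+n
  ... | inj₁ m<1+n = ≤-trans (rank-mono (s≤s⁻¹ m<1+n)) (rank-≤-suc n)
  ... | inj₂ refl  = ≤-refl

  rank-strict : ∀ {m n} → A m → m < n → rank A? m < rank A? n
  rank-strict {m} {n} Am m<n = subst (_≤ rank A? n) (rank-suc Am) (rank-mono m<n)

  rank-cancel-< : ∀ {m n} → rank A? m < rank A? n → m < n
  rank-cancel-< r<r = ≰⇒> λ n≤m → <⇒≱ r<r (rank-mono n≤m)

  rank-cancel-≤ : ∀ {m n} → A m → rank A? n ≤ rank A? m → n ≤ m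
  rank-cancel-≤ Am r≤r = ≮⇒≥ λ m<n → <⇒≱ (rank-strict Am m<n) r≤r

  rank-injective : ∀ {m n} → A m → A n → rank A? m ≡ rank A? n → m ≡ n
  rank-injective Am An eq =
    ≤-antisym (rank-cancel-≤ An (≤-reflexive eq)) (rank-cancel-≤ Am (≤-reflexive (sym eq)))

  -- The counting function rises only at elements of `A` and by one each time, so it skips no value.
  select : ∀ n {i} → i < rank A? n → ∃[ m ] A m × rank A? m ≡ i
  select (suc n) i<r with A? n
  ... | no  _  = select n i<r
  ... | yes An with m<1+n⇒m<n∨m≡n i<r
  ...   | inj₁ i<r′ = select n i<r′
  ...   | inj₂ refl = n , An , refl

  module _ {I : Set} (pos : I → ℕ) (x : I → ℕ) where

    -- The sequence may be a run of consecutive elements of `A` that starts late: the number `r` of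
    -- earlier elements cancels in `i + k = 2j`.
    ranked⇒AP : ∀ r → (∀ i → A (x i)) → (∀ i → rank A? (x i) ≡ r + pos i) →
      HasDoubleAP pos x → HasRankedAP A?
    ranked⇒AP r Ax rank-x (i , j , k , i<j , j<k , AP , i+k≡2j) =
      x i , x j , x k , (Ax i , Ax j , Ax k) , increasing i<j , increasing j<k , AP , (begin
        rank A? (x i) + rank A? (x k)  ≡⟨ cong₂ _+_ (rank-x i) (rank-x k) ⟩
        r + pos i + (r + pos k)        ≡⟨ collect r (pos i) (pos k) ⟩
        2 * r + (pos i + pos k)        ≡⟨ cong (2 * r +_) i+k≡2j ⟩
        2 * r + 2 * pos j              ≡⟨ *-distribˡ-+ 2 r (pos j) ⟨
        2 * (r + pos j)                ≡⟨ cong (2 *_) (rank-x j) ⟨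
        2 * rank A? (x j)              ∎)
      where
      open ≡-Reasoning
      increasing : ∀ {i j} → pos i < pos j → x i < x j
      increasing {i} {j} i<j =
        rank-cancel-< (subst₂ _<_ (sym (rank-x i)) (sym (rank-x j)) (+-monoʳ-< r i<j))
      collect : ∀ r p q → r + p + (r + q) ≡ 2 * r + (p + q)
      collect = solve-∀

  -- The two hypotheses identify `I` with an initial segment of the natural numbers, which treats
  -- finite and infinite enumerations at once.
  module _ {I : Set} (pos : I → ℕ)
    (pos-injective : ∀ {i j} → pos i ≡ pos j → i ≡ j)
    (pos-initial : ∀ i {n} → n < pos i → ∃[ j ] pos j ≡ n)
    where

    -- Strong induction on the position. Were the rank too large, an earlier term would have rank
    -- `pos i`, against its own smaller position. Were it too small, the earlier term at position
    -- `rank A? (x i)` would share the rank of `x i`.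
    rank-enumeration : ∀ x → Enumerates pos x A → ∀ i → rank A? (x i) ≡ pos i
    rank-enumeration x (increasing , A⊆x , x⊆A) i = <-rec
      (λ n → ∀ i → pos i ≡ n → rank A? (x i) ≡ pos i)
      (λ { _ ih i refl → ≤-antisym
             (≮⇒≥ (λ i<r → tooFewBelow (λ j j<i → ih j<i j refl) (select (x i) i<r) i<r))
             (≮⇒≥ (λ r<i → tooManyBelow (λ j j<i → ih j<i j refl) (pos-initial i r<i) r<i)) })
      (pos i) i refl
      where
      reflects : ∀ {i j} → x i < x j → pos i < pos j
      reflects {i} {j} xi<xj = ≰⇒> λ j≤i → <⇒≱ xi<xj (mono (m≤n⇒m<n∨m≡n j≤i))
        where
        mono : pos j < pos i ⊎ pos j ≡ pos i → x j ≤ x i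
        mono (inj₁ j<i) = <⇒≤ (increasing j i j<i)
        mono (inj₂ j≡i) = ≤-reflexive (cong x (pos-injective j≡i))
      tooFewBelow : ∀ {i} → (∀ j → pos j < pos i → rank A? (x j) ≡ pos j) →
        ∃[ m ] A m × rank A? m ≡ pos i → ¬ pos i < rank A? (x i)
      tooFewBelow {i} ih (m , Am , r≡i) i<r with A⊆x Am
      ... | j , refl = <-irrefl (trans (sym (ih j j<i)) r≡i) j<i
        where
        j<i : pos j < pos i
        j<i = reflects (rank-cancel-< (subst (_< rank A? (x i)) (sym r≡i) i<r))
      tooManyBelow : ∀ {i} → (∀ j → pos j < pos i → rank A? (x j) ≡ pos j) →
        ∃[ j ] pos j ≡ rank A? (x i) → ¬ rank A? (x i) < pos i
      tooManyBelow {i} ih (j , j≡r) r<i = <-irrefl (trans (ih j j<i) j≡r)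
        (rank-strict (x⊆A (j , refl)) (increasing j i j<i))
        where
        j<i : pos j < pos i
        j<i = subst (_< pos i) (sym j≡r) r<i

    enumerated⇒ranked : ∀ x → Enumerates pos x A → HasDoubleAP pos x → HasRankedAP A?
    enumerated⇒ranked x enum@(_ , _ , x⊆A) =
      ranked⇒AP pos x 0 (λ i → x⊆A (i , refl)) (rank-enumeration x enum)

    ranked⇒enumerated : ∀ x → Enumerates pos x A → HasRankedAP A? → HasDoubleAP pos x
    ranked⇒enumerated x enum@(_ , A⊆x , _) (_ , _ , _ , (Aa , Ab , Ac) , a<b , b<c , AP , AP′)
      with A⊆x Aa | A⊆x Ab | A⊆x Ac
    ... | i , refl | j , refl | k , refl = i , j , k ,
      subst₂ _<_ (r≡ i) (r≡ j) (rank-strict Aa a<b) ,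
      subst₂ _<_ (r≡ j) (r≡ k) (rank-strict Ab b<c) ,
      AP , subst₂ _≡_ (cong₂ _+_ (r≡ i) (r≡ k)) (cong (2 *_) (r≡ j)) AP′
      where
      r≡ : ∀ i → rank A? (x i) ≡ pos i
      r≡ = rank-enumeration x enum

    -- The enumeration sends each position to the element of that rank, which is unique.
    enumerate : (∀ i → ∃[ n ] A n × rank A? n ≡ pos i) →
      (∀ {n} → A n → ∃[ i ] pos i ≡ rank A? n) →
      HasRankedAP A? → ∃[ x ] Enumerates pos x A × HasDoubleAP pos x
    enumerate element index AP = x , enum , ranked⇒enumerated x enum AP
      where
      x : I → ℕ
      x i = proj₁ (element i)
      Ax : ∀ i → A (x i)
      Ax i = proj₁ (proj₂ (element i))
      rank-x : ∀ i → rank A? (x i) ≡ pos i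
      rank-x i = proj₂ (proj₂ (element i))
      enum : Enumerates pos x A
      enum = (λ i j i<j → rank-cancel-< (subst₂ _<_ (sym (rank-x i)) (sym (rank-x j)) i<j)) ,
        (λ An → let i , i≡r = index An
                in i , rank-injective (Ax i) An (trans (rank-x i) i≡r)) ,
        λ { (i , refl) → Ax i }

  toℕ-initial : ∀ {p} (i : Fin p) {n} → n < toℕ i → ∃[ j ] toℕ {p} j ≡ n
  toℕ-initial i n<i = fromℕ< n<p , toℕ-fromℕ< n<p
    where
    n<p : _ < _
    n<p = <-trans n<i (toℕ<n i)

  finite⇒ranked : FiniteSetHasDoubleAP A → HasRankedAP A?
  finite⇒ranked (p , x , enum , AP) = enumerated⇒ranked toℕ toℕ-injective toℕ-initial x enum AP

  infinite⇒ranked : InfiniteSetHasDoubleAP A → HasRankedAP A?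
  infinite⇒ranked (x , enum , AP) = enumerated⇒ranked id id (λ i {n} _ → n , refl) x enum AP

  set⇒ranked : SetHasDoubleAP A → HasRankedAP A?
  set⇒ranked (inj₁ AP) = finite⇒ranked AP
  set⇒ranked (inj₂ AP) = infinite⇒ranked AP

  ranked⇒finite : ∀ N → (∀ {n} → A n → n < N) → HasRankedAP A? → FiniteSetHasDoubleAP A
  ranked⇒finite N A<N AP = rank A? N ,
    enumerate toℕ toℕ-injective toℕ-initial
      (λ i → select N (toℕ<n i))
      (λ An → let r<r = rank-strict An (A<N An) in fromℕ< r<r , toℕ-fromℕ< r<r)
      AP

  ranked⇒infinite : (∀ N → ∃[ n ] N ≤ n × A n) → HasRankedAP A? → InfiniteSetHasDoubleAP A
  ranked⇒infinite unbounded =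
    enumerate id id (λ i {n} _ → n , refl)
      (λ i → let N , i<r = reaches i in select N i<r)
      (λ {n} _ → rank A? n , refl)
    where
    reaches : ∀ i → ∃[ N ] i < rank A? N
    reaches zero    = let n , _ , An = unbounded 0
                      in suc n , subst (0 <_) (sym (rank-suc An)) z<s
    reaches (suc i) = let N , i<r = reaches i
                          n , N≤n , An = unbounded N
                      in suc n , subst (suc i <_) (sym (rank-suc An))
                                   (s<s (<-≤-trans i<r (rank-mono N≤n)))

-- Compactness

module Classical (em : ExcludedMiddle 0ℓ) where

  byContradiction : {P : Set} → ¬ ¬ P → P
  byContradiction = decidable-stable em

  ¬∀⇒∃¬ : {A : Set} {P : Pred A 0ℓ} → ¬ (∀ a → P a) → ∃[ a ] ¬ P a
  ¬∀⇒∃¬ ¬∀ = byContradiction λ ¬∃ → ¬∀ λ a → byContradiction λ ¬Pa → ¬∃ (a , ¬Pa)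

  -- Induction on `k`. If the value `k` fails at some `n₀`, it fails at all larger arguments, so
  -- asking at `n ⊔ n₀` always yields a smaller value.
  pigeonhole : ∀ k (P : ℕ → ℕ → Set) → (∀ {c m n} → m ≤ n → P c n → P c m) →
    (∀ n → ∃[ c ] c ≤ k × P c n) → ∃[ c ] ∀ n → P c n
  pigeonhole k P antitone inhabited with em {∀ n → P k n}
  ... | yes Pk = k , Pk
  pigeonhole zero P antitone inhabited | no ¬Pk =
    contradiction (λ n → onlyZero (inhabited n)) ¬Pk
    where
    onlyZero : ∀ {n} → ∃[ c ] c ≤ 0 × P c n → P 0 n
    onlyZero (_ , z≤n , P0n) = P0n
  pigeonhole (suc k) P antitone inhabited | no ¬Pk with ¬∀⇒∃¬ ¬Pk
  ... | n₀ , ¬Pkn₀ = pigeonhole k P antitone λ n → below (inhabited (n ⊔ n₀))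
    where
    below : ∀ {n} → ∃[ c ] c ≤ suc k × P c (n ⊔ n₀) → ∃[ c ] c ≤ k × P c n
    below {n} (c , c≤1+k , Pc) = c ,
      s≤s⁻¹ (≤∧≢⇒< c≤1+k λ { refl → ¬Pkn₀ (antitone (m≤n⊔m n n₀) Pc) }) ,
      antitone (m≤m⊔n n n₀) Pc

  module _ (k : ℕ) (P : ℕ → (ℕ → ℕ) → Set)
    (antitone : ∀ {m n f} → m ≤ n → P n f → P m f)
    (local : ∀ {n f g} → AgreeBelow n f g → P n f → P n g)
    (bounded : ∀ {n f} → P n f → ∀ i → i < n → f i ≤ k)
    (satisfiable : ∀ n → ∃[ f ] P n f)
    where

    -- The nodes of König's tree with good continuations to every depth; only the first `m` values
    -- of `p` matter.
    Extensible : ℕ → (ℕ → ℕ) → Set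
    Extensible m p = ∀ n → ∃[ f ] AgreeBelow m p f × P n f

    -- The next value is at most `k`, so by the pigeonhole principle a single value admits good
    -- continuations to every depth.
    extendByOne : ∀ m p → Extensible m p → ∃[ q ] AgreeBelow m p q × Extensible (suc m) q
    extendByOne m p extensible
      with pigeonhole k (λ c n → ∃[ f ] AgreeBelow m p f × f m ≡ c × P n f)
             (λ m≤n (f , p≡f , fm≡c , Pf) → f , p≡f , fm≡c , antitone m≤n Pf)
             -- The depth is raised to at least `suc m` because only values below the depth are
             -- bounded.
             (λ n → let f , p≡f , Pf = extensible (n ⊔ suc m) in
                f m , bounded Pf m (m≤n⊔m n (suc m)) ,
                f , p≡f , refl , antitone (m≤m⊔n n (suc m)) Pf)
    ... | c , branch with branch 0
    ... | q , p≡q , qm≡c , _ = q , p≡q , λ n →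
      let f , p≡f , fm≡c , Pf = branch n in f , agree p≡f fm≡c , Pf
      where
      agree : ∀ {f} → AgreeBelow m p f → f m ≡ c → AgreeBelow (suc m) q f
      agree p≡f fm≡c i i<1+m with m<1+n⇒m<n∨m≡n i<1+m
      ... | inj₁ i<m  = trans (sym (p≡q i i<m)) (p≡f i i<m)
      ... | inj₂ refl = trans qm≡c (sym fm≡c)

    prefix : ∀ m → ∃[ p ] Extensible m p
    prefix zero    = (λ _ → 0) , λ n → let f , Pf = satisfiable n in f , (λ _ ()) , Pf
    prefix (suc m) = let p , extensible = prefix m
                         q , _ , extensible′ = extendByOne m p extensible
                     in q , extensible′

    limit : ℕ → ℕ
    limit m = proj₁ (prefix (suc m)) m

    -- Each extension keeps the values already chosen, so the diagonal agrees with every prefix.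
    prefix≡limit : ∀ m → AgreeBelow m (proj₁ (prefix m)) limit
    prefix≡limit (suc m) i i<1+m with m<1+n⇒m<n∨m≡n i<1+m
    ... | inj₁ i<m  = trans (sym (proj₁ (proj₂ (extendByOne m _ (proj₂ (prefix m)))) i i<m))
                            (prefix≡limit m i i<m)
    ... | inj₂ refl = refl

    compactness : ∃[ f ] ∀ n → P n f
    compactness = limit , λ n →
      let f , p≡f , Pf = proj₂ (prefix n) n
      in local (λ i i<n → trans (sym (p≡f i i<n)) (prefix≡limit n i i<n)) Pf

  -- If no length suffices, compactness yields an infinite word all of whose prefixes avoid squares;
  -- yet a square in it lies inside the prefix of length `m + ℓ + ℓ`.
  infiniteWords⇒longPrefixes :
    InfiniteWordsHaveAdditiveSquares → LongPrefixesHaveAdditiveSquares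
  infiniteWords⇒longPrefixes squares k 1<k = byContradiction λ ¬R →
    let
      w , avoids = compactness k Avoids
        (λ {_} {_} {f} m≤n (f∈k , ¬square) →
           (λ i i<m → f∈k i (<-≤-trans i<m m≤n)) , ¬square ∘ square-mono {f = f} m≤n)
        (λ {_} {f} {g} f≡g (f∈k , ¬square) →
           (λ i i<n → subst (Alphabet k) (f≡g i i<n) (f∈k i i<n)) ,
           ¬square ∘ square-cong {f = g} (λ i i<n → sym (f≡g i i<n)))
        (λ (f∈k , _) i i<n → proj₂ (f∈k i i<n))
        (λ n → counterexample (¬∃⟶∀¬ ¬R n))
      m , ℓ , square = squares k 1<k w λ i → proj₁ (avoids (suc i)) i ≤-refl
    in proj₂ (avoids (m + ℓ + ℓ)) (m , ℓ , map₂ (≤-refl ,_) square)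
    where
    -- The alphabet is imposed below `n` only, since compactness requires a condition on the first
    -- `n` values.
    Avoids : ℕ → (ℕ → ℕ) → Set
    Avoids n f = (∀ i → i < n → f i ∈ Alphabet k) × ¬ HasAdditiveSquareBelow n f
    counterexample : ∀ {n} →
      ¬ (∀ f → (∀ i → f i ∈ Alphabet k) → HasAdditiveSquareBelow n f) → ∃[ f ] Avoids n f
    counterexample ¬∀ with ¬∀⇒∃¬ ¬∀
    ... | f , ¬implies = f ,
      (λ i _ → byContradiction λ fi∉k → ¬implies λ f∈k → contradiction (f∈k i) fi∉k) ,
      λ square → ¬implies λ _ → square

  -- Covers

  em? : (A : Pred ℕ 0ℓ) → Decidable A
  em? _ _ = em

  ranked⇒set : ∀ {A : Pred ℕ 0ℓ} (A? : Decidable A) → HasRankedAP A? → SetHasDoubleAP A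
  ranked⇒set {A} A? AP with em {∃[ N ] ∀ {n} → A n → n < N}
  ... | yes (N , A<N) = inj₁ (ranked⇒finite A? N A<N AP)
  ... | no  ¬bounded  = inj₂ (ranked⇒infinite A? unbounded AP)
    where
    unbounded : ∀ N → ∃[ n ] N ≤ n × A n
    unbounded N = byContradiction λ ¬∃ →
      ¬bounded (N , λ An → ≰⇒> λ N≤n → ¬∃ (_ , N≤n , An))

  -- The sets may reach outside the window, so the same sets serve for a shorter window in the
  -- induction; ranks still count all their elements.
  RankedAPBound : ℕ → ℕ → Set₁
  RankedAPBound t T = ∀ a → 1 ≤ a → (A : Fin t → Pred ℕ 0ℓ) →
    (∀ {m} → m ∈ Interval a T → ∃[ q ] A q m) → ∃[ q ] HasRankedAP (em? (A q))

  -- If A₀ meets every window of length N then its elements have gaps at most N;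
  -- otherwise the remaining t sets cover a window of length N.

  longSequences⇒bound : LongSequencesHaveDoubleAPs → ∀ t → ∃[ T ] RankedAPBound t T
  -- A window of length 1 is nonempty, so no sets cannot cover it.
  longSequences⇒bound doubleAPs zero = 1 , λ a _ A cover →
    contradiction (proj₁ (cover (≤-refl , m<m+n a z<s))) λ ()
  longSequences⇒bound doubleAPs (suc t)
    with longSequences⇒bound doubleAPs t
  -- The gaps will be at most `N`; adding 2 makes the bound exceed 1.
  ... | N , bound with doubleAPs (2 + N) (s≤s (s≤s z≤n))
  -- `S` blocks of length `N` supply `S` elements; the further `N` keeps the window after each of
  -- these inside the interval.
  ... | S , doubleAP = N + S * N , bound′
    where
    bound′ : RankedAPBound (suc t) (N + S * N)
    bound′ a 1≤a A cover
      with em {∃[ b ] a ≤ b × b + N ≤ a + (N + S * N) × (∀ m → m ∈ Interval b N → ¬ A zero m)}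
    ... | yes (b , a≤b , b+N≤ , missed) =
      let q , AP = bound b (≤-trans 1≤a a≤b) (A ∘ suc) cover′ in suc q , AP
      where
      cover′ : ∀ {m} → m ∈ Interval b N → ∃[ q ] A (suc q) m
      cover′ {m} m∈@(b≤m , m<b+N) with cover (≤-trans a≤b b≤m , <-≤-trans m<b+N b+N≤)
      ... | zero  , A₀m = contradiction A₀m (missed m m∈)
      ... | suc q , Aqm = q , Aqm
    ... | no ¬missed = zero , ranked⇒AP A₀? toℕ y (rank A₀? a) (proj₁ ∘ y-spec) (proj₂ ∘ y-spec)
        (doubleAP y (λ i → ≤-trans 1≤a (a≤y i)) increasing gaps)
      where
      A₀? : Decidable (A zero)
      A₀? = em? (A zero)

      hit : ∀ b → a ≤ b → b + N ≤ a + (N + S * N) → ∃[ m ] m ∈ Interval b N × A zero m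
      hit b a≤b b+N≤ = byContradiction λ ¬∃ →
        ¬missed (b , a≤b , b+N≤ , λ m m∈ A₀m → ¬∃ (m , m∈ , A₀m))

      within : ∀ {i} → i ≤ S → a + i * N + N ≤ a + (N + S * N)
      within {i} i≤S = begin
        a + i * N + N    ≡⟨ +-assoc a (i * N) N ⟩
        a + (i * N + N)  ≤⟨ +-monoʳ-≤ a (+-monoˡ-≤ N (*-monoˡ-≤ N i≤S)) ⟩
        a + (S * N + N)  ≡⟨ cong (a +_) (+-comm (S * N) N) ⟩
        a + (N + S * N)  ∎
        where open ≤-Reasoning

      -- Each of the successive blocks of length `N` from `a` on contains an element of `A zero`.
      growth : ∀ i → i ≤ S → rank A₀? a + i ≤ rank A₀? (a + i * N)
      growth zero    _     = ≤-reflexive (trans (+-identityʳ _) (cong (rank A₀?) (sym (+-identityʳ a))))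
      growth (suc i) 1+i≤S
        with hit (a + i * N) (m≤m+n a (i * N)) (within (<⇒≤ 1+i≤S))
      ... | m , (b≤m , m<b+N) , A₀m = begin
        rank A₀? a + suc i           ≡⟨ +-suc (rank A₀? a) i ⟩
        suc (rank A₀? a + i)         ≤⟨ s≤s (growth i (<⇒≤ 1+i≤S)) ⟩
        suc (rank A₀? (a + i * N))   ≤⟨ s≤s (rank-mono A₀? b≤m) ⟩
        suc (rank A₀? m)             ≤⟨ rank-strict A₀? A₀m m<b+N ⟩
        rank A₀? (a + i * N + N)     ≡⟨ cong (rank A₀?) (shift a (i * N) N) ⟩
        rank A₀? (a + suc i * N)     ∎
        where
        open ≤-Reasoning
        shift : ∀ a b c → a + b + c ≡ a + (c + b)
        shift = solve-∀

      rank-below : ∀ (i : Fin S) → rank A₀? a + toℕ i < rank A₀? (a + S * N)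
      rank-below i = <-≤-trans (+-monoʳ-< (rank A₀? a) (toℕ<n i)) (growth S ≤-refl)

      -- The first `S` elements of `A zero` from `a` on.
      y : Fin S → ℕ
      y i = proj₁ (select A₀? (a + S * N) (rank-below i))

      y-spec : ∀ i → A zero (y i) × rank A₀? (y i) ≡ rank A₀? a + toℕ i
      y-spec i = proj₂ (select A₀? (a + S * N) (rank-below i))

      rank-y : ∀ i → rank A₀? (y i) ≡ rank A₀? a + toℕ i
      rank-y i = proj₂ (y-spec i)

      a≤y : ∀ i → a ≤ y i
      a≤y i = rank-cancel-≤ A₀? (proj₁ (y-spec i))
        (subst (rank A₀? a ≤_) (sym (rank-y i)) (m≤m+n _ (toℕ i)))

      y<a+SN : ∀ i → y i < a + S * N
      y<a+SN i = rank-cancel-< A₀? (subst (_< rank A₀? (a + S * N)) (sym (rank-y i)) (rank-below i))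

      increasing : StrictlyIncreasing toℕ y
      increasing i j i<j = rank-cancel-< A₀?
        (subst₂ _<_ (sym (rank-y i)) (sym (rank-y j)) (+-monoʳ-< (rank A₀? a) i<j))

      gaps : GapsAtMost toℕ y (2 + N)
      gaps i j j≡1+i
        -- The window just after `y i` contains an element `m`, and `y j`, the next element after
        -- `y i`, cannot exceed `m`.
        with hit (suc (y i)) (≤-trans (a≤y i) (n≤1+n _))
               (≤-trans (+-monoˡ-≤ N (y<a+SN i)) (within ≤-refl))
      ... | m , (yi<m , m<) , A₀m = m≤n+o⇒m∸n≤o (y j) (y i) (begin
        y j               ≤⟨ rank-cancel-≤ A₀? A₀m next ⟩
        m                 ≤⟨ <⇒≤ m< ⟩
        suc (y i + N)     ≡⟨ +-suc (y i) N ⟨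
        y i + suc N       ≤⟨ +-monoʳ-≤ (y i) (n≤1+n (suc N)) ⟩
        y i + (2 + N)     ∎)
        where
        open ≤-Reasoning
        next : rank A₀? (y j) ≤ rank A₀? m
        next = begin
          rank A₀? (y j)              ≡⟨ rank-y j ⟩
          rank A₀? a + toℕ j          ≡⟨ cong (rank A₀? a +_) j≡1+i ⟩
          rank A₀? a + suc (toℕ i)    ≡⟨ +-suc (rank A₀? a) (toℕ i) ⟩
          suc (rank A₀? a + toℕ i)    ≡⟨ cong suc (rank-y i) ⟨
          suc (rank A₀? (y i))        ≤⟨ rank-strict A₀? (proj₁ (y-spec i)) yi<m ⟩
          rank A₀? m                  ∎

  longSequences⇒intervalCovers :
    LongSequencesHaveDoubleAPs → CoversOfLongIntervalsHaveDoubleAPs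
  longSequences⇒intervalCovers doubleAPs t _ with longSequences⇒bound doubleAPs t
  ... | T , bound = T , λ a 1≤a A (cover , A⊆) →
    let q , AP = bound a 1≤a A cover
    in q , ranked⇒finite (em? (A q)) (a + T) (λ Aqn → proj₂ (A⊆ (q , Aqn))) AP

  -- Cutting the sets off above `T` leaves the ranks of the surviving elements unchanged, so a
  -- progression found there persists in the full set.
  intervalCovers⇒covers :
    CoversOfLongIntervalsHaveDoubleAPs → CoversOfPositivesHaveDoubleAPs
  intervalCovers⇒covers doubleAPs t 1<t A (cover , A⊆) with doubleAPs t 1<t
  ... | T , bound
    with bound 1 ≤-refl (λ q n → A q n × n < 1 + T)
           ((λ (1≤n , n<1+T) → let q , Aqn = cover 1≤n in q , Aqn , n<1+T) ,
            (λ (q , Aqn , n<1+T) → A⊆ (q , Aqn) , n<1+T))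
  ... | q , AP = q , ranked⇒set (em? (A q)) (unrestrict (finite⇒ranked (em? _) AP))
    where
    same : ∀ {n} → n < 1 + T → rank (em? (λ m → A q m × m < 1 + T)) n ≡ rank (em? (A q)) n
    same n<1+T = rank-cong _ _ _ λ m m<n → proj₁ , (_, <-trans m<n n<1+T)
    unrestrict : HasRankedAP (em? (λ m → A q m × m < 1 + T)) → HasRankedAP (em? (A q))
    unrestrict (a , b , c , ((Aa , a<) , (Ab , b<) , (Ac , c<)) , a<b , b<c , AP , AP′) =
      a , b , c , (Aa , Ab , Ac) , a<b , b<c , AP ,
      subst₂ _≡_ (cong₂ _+_ (same a<) (same c<)) (cong (2 *_) (same b<)) AP′

  -- The translates by 0, …, n − 1 of a sequence with gaps at most n cover
  -- everything from its first term on; that term is first moved to 1.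

  covers⇒infiniteSequences :
    CoversOfPositivesHaveDoubleAPs → InfiniteSequencesHaveDoubleAPs
  covers⇒infiniteSequences doubleAPs n 1<n x positive increasing gaps =
    fromTranslate (doubleAPs n 1<n A (cover , λ { (q , i , refl) → s≤s z≤n }))
    where
    x₀≤x : ∀ i → x 0 ≤ x i
    x₀≤x zero    = ≤-refl
    x₀≤x (suc i) = <⇒≤ (increasing 0 (suc i) z<s)

    y : ℕ → ℕ
    y i = suc (x i ∸ x 0)

    y+x₀ : ∀ i → y i + x 0 ≡ suc (x i)
    y+x₀ i = cong suc (m∸n+n≡m (x₀≤x i))

    y-increasing : StrictlyIncreasing id y
    y-increasing i j i<j = s<s (∸-monoˡ-< (increasing i j i<j) (x₀≤x i))

    y-gap : ∀ i → y (suc i) ≤ y i + n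
    y-gap i = +-cancelʳ-≤ (x 0) _ _ (begin
      y (suc i) + x 0   ≡⟨ y+x₀ (suc i) ⟩
      suc (x (suc i))   ≤⟨ s≤s (m≤n+m∸n (x (suc i)) (x i)) ⟩
      suc (x i) + (x (suc i) ∸ x i)  ≤⟨ +-monoʳ-≤ (suc (x i)) (gaps i (suc i) refl) ⟩
      suc (x i) + n     ≡⟨ cong (_+ n) (y+x₀ i) ⟨
      y i + x 0 + n     ≡⟨ +-swapʳ (y i) (x 0) n ⟩
      y i + n + x 0     ∎)
      where
      open ≤-Reasoning

    A : Fin n → Pred ℕ 0ℓ
    A q m = ∃[ i ] y i + toℕ q ≡ m

    -- Induction on `m`; the index advances exactly when the next term is reached.
    locate : ∀ m → ∃[ i ] y i ≤ suc m × suc m < y (suc i)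
    locate zero = 0 , ≤-reflexive (cong suc (n∸n≡0 (x 0))) ,
      subst (_< y 1) (cong suc (n∸n≡0 (x 0))) (y-increasing 0 1 ≤-refl)
    locate (suc m) with locate m
    ... | i , yi≤ , <yi+1 with m≤n⇒m<n∨m≡n <yi+1
    ...   | inj₁ <yi+1′ = i , m≤n⇒m≤1+n yi≤ , <yi+1′
    ...   | inj₂ ≡yi+1  = suc i , ≤-reflexive (sym ≡yi+1) ,
      subst (_< y (2 + i)) (sym ≡yi+1) (y-increasing (suc i) (2 + i) ≤-refl)

    cover : ∀ {m} → 1 ≤ m → ∃[ q ] A q m
    cover {suc m} _ with locate m
    -- The translate is the distance from the last term not exceeding `suc m`, less than the gap and
    -- hence than `n`.
    ... | i , yi≤ , <yi+1 = fromℕ< d<n , i ,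
      trans (cong (y i +_) (toℕ-fromℕ< d<n)) (m+[n∸m]≡n yi≤)
      where
      d<n : suc m ∸ y i < n
      d<n = +-cancelˡ-< (y i) _ _
        (subst (_< y i + n) (sym (m+[n∸m]≡n yi≤)) (<-≤-trans <yi+1 (y-gap i)))

    -- The progression comes with some enumeration of `A q`; ranks carry it over to the enumeration
    -- by `y i + toℕ q`, whose constant shift against `x` then cancels.
    fromTranslate : ∃[ q ] SetHasDoubleAP (A q) → HasDoubleAP id x
    fromTranslate (q , AP)
      with ranked⇒enumerated (em? (A q)) id id (λ i {n} _ → n , refl) (λ i → y i + toℕ q)
             ((λ i j i<j → +-monoˡ-< (toℕ q) (y-increasing i j i<j)) , id , id)
             (set⇒ranked (em? (A q)) AP)
    ... | i , j , k , i<j , j<k , AP-y , i+k≡2j = i , j , k , i<j , j<k , AP-x , i+k≡2j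
      where
      open ≡-Reasoning
      s : ℕ
      s = toℕ q
      shift : ∀ i → suc (x i) + s ≡ y i + s + x 0
      shift i = trans (cong (_+ s) (sym (y+x₀ i))) (+-swapʳ (y i) (x 0) s)
      collect : ∀ a b c → 2 + 2 * c + (a + b) ≡ suc a + c + (suc b + c)
      collect = solve-∀
      collect-+ : ∀ a b c → a + c + (b + c) ≡ a + b + 2 * c
      collect-+ = solve-∀
      collect-2* : ∀ a b → 2 * a + 2 * b ≡ 2 * (a + b)
      collect-2* = solve-∀
      expand : ∀ a c → 2 * (suc a + c) ≡ 2 + 2 * c + 2 * a
      expand = solve-∀
      AP-x : x i + x k ≡ 2 * x j
      AP-x = +-cancelˡ-≡ (2 + 2 * s) _ _ (begin
        2 + 2 * s + (x i + x k)                 ≡⟨ collect (x i) (x k) s ⟩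
        suc (x i) + s + (suc (x k) + s)         ≡⟨ cong₂ _+_ (shift i) (shift k) ⟩
        y i + s + x 0 + (y k + s + x 0)         ≡⟨ collect-+ (y i + s) (y k + s) (x 0) ⟩
        y i + s + (y k + s) + 2 * x 0           ≡⟨ cong (_+ 2 * x 0) AP-y ⟩
        2 * (y j + s) + 2 * x 0                 ≡⟨ collect-2* (y j + s) (x 0) ⟩
        2 * (y j + s + x 0)                     ≡⟨ cong (2 *_) (shift j) ⟨
        2 * (suc (x j) + s)                     ≡⟨ expand (x j) s ⟩
        2 + 2 * s + 2 * x j                     ∎)

theorem4 : ExcludedMiddle 0ℓ →
    (InfiniteWordsHaveAdditiveSquares ⇔ LongWordsHaveAdditiveSquares) ×
    (InfiniteWordsHaveAdditiveSquares ⇔ InfiniteSequencesHaveDoubleAPs) ×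
    (InfiniteWordsHaveAdditiveSquares ⇔ LongSequencesHaveDoubleAPs) ×
    (InfiniteWordsHaveAdditiveSquares ⇔ CoversOfPositivesHaveDoubleAPs) ×
    (InfiniteWordsHaveAdditiveSquares ⇔ CoversOfLongIntervalsHaveDoubleAPs)
theorem4 em =
  mk⇔ (longPrefixes⇒longWords ∘ infiniteWords⇒longPrefixes) longWords⇒infiniteWords ,
  mk⇔ (longSequences⇒infiniteSequences ∘ to-longSequences) infiniteSequences⇒infiniteWords ,
  mk⇔ to-longSequences (infiniteSequences⇒infiniteWords ∘ longSequences⇒infiniteSequences) ,
  mk⇔ (intervalCovers⇒covers ∘ to-intervalCovers) from-covers ,
  mk⇔ to-intervalCovers (from-covers ∘ intervalCovers⇒covers)
  where
  open Classical em
  to-longSequences : InfiniteWordsHaveAdditiveSquares → LongSequencesHaveDoubleAPs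
  to-longSequences = longPrefixes⇒longSequences ∘ infiniteWords⇒longPrefixes
  to-intervalCovers : InfiniteWordsHaveAdditiveSquares → CoversOfLongIntervalsHaveDoubleAPs
  to-intervalCovers = longSequences⇒intervalCovers ∘ to-longSequences
  from-covers : CoversOfPositivesHaveDoubleAPs → InfiniteWordsHaveAdditiveSquares
  from-covers = infiniteSequences⇒infiniteWords ∘ covers⇒infiniteSequences
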